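{- For every integer $m\ge2$, $$S_m^2<S_{m+1}S_{m-1}<\Big(1+\frac{1}{m(m-1)}\Big)S_m^2.$$
   Context: $(S_n)_{n\ge0}$ is the integer sequence defined by $S_0=1$, $S_1=4$ and $(n+1)^2S_{n+1}=4(3n^2+3n+1)S_n-32n^2S_{n-1}$ for $n\ge1$; equivalently $S_n=\sum_{k=0}^n\binom nk\binom{2k}k\binom{2n-2k}{n-k}$. -}

module Defs where

open import Data.Nat.Base as ℕ using (ℕ; suc; NonZero; z≤n; s≤s)
open import Data.Integer.Base using (ℤ; +_; _+_; _-_; _*_; _^_)
open import Data.Rational.Base using (ℚ; _/_)
open import Relation.Binary.PropositionalEquality using (_≡_)

-- S is the integer sequence with these initial values and this recurrence.
-- They determine S uniquely, and S n = Σ_{k ≤ n} C(n,k) C(2k,k) C(2n−2k,n−k)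
-- is the solution.  Under 1 ≤ n the truncated n ∸ 1 is the true predecessor.
record IsSequenceS (S : ℕ → ℤ) : Set where
  field
    S₀         : S 0 ≡ + 1
    S₁         : S 1 ≡ + 4
    recurrence : ∀ n → 1 ℕ.≤ n →
      (+ n + + 1) ^ 2 * S (n ℕ.+ 1)
        ≡ + 4 * (+ 3 * (+ n) ^ 2 + + 3 * + n + + 1) * S n
          - + 32 * (+ n) ^ 2 * S (n ℕ.∸ 1)

m[m∸1]≢0 : ∀ {m} → 2 ℕ.≤ m → NonZero (m ℕ.* (m ℕ.∸ 1))
m[m∸1]≢0 (s≤s (s≤s z≤n)) = _

1/m[m-1] : ∀ m → 2 ℕ.≤ m → ℚ
1/m[m-1] m 2≤m = _/_ (+ 1) (m ℕ.* (m ℕ.∸ 1)) {{m[m∸1]≢0 2≤m}}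

{-# OPTIONS --safe #-}

-- With m and r, s, t = S (m − 1), S m, S (m + 1), put d = 8 (m − 1) r − m s.
-- The recurrence becomes (m² − 1) d′ = 4 s + 4 m² d for the next defect d′, so
-- d stays positive, and m² d ≤ 3 s is self-propagating from m = 8 onwards:
-- then (m² − 1) d′ ≤ 16 s, while (m + 1) t = 8 m s − d′ is close to 8 m s.
-- With p = 3 s − m² d ≥ 0, both inequalities follow from the identities
--   8 (m² − 1)² (t r − s²) = (8m² − 4m − 8) s² + (4m³ − 8m − 16) s d + 4 d p,
--   8 (m + 1)² (m − 1) ((m(m − 1) + 1) s² − m(m − 1) t r)
--     = 16 s² + 4 m s d + (4m² − 8) s p + 4 m³ d²,
-- and the cases 2 ≤ m ≤ 7 are numerical.
module Submission where

open import Defs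
open import Data.Nat.Base as ℕ using (ℕ; suc; z≤n; s≤s)
import Data.Nat.Properties as ℕ
open import Data.Integer.Base as ℤ using (ℤ; +_; 0ℤ; +≤+; +<+)
import Data.Integer.Properties as ℤ
open import Data.Integer.Solver using (module +-*-Solver)
open import Data.Rational.Literals using (fromℤ)
import Data.Rational.Properties as ℚ
import Data.Rational.Unnormalised.Base as ℚᵘ
import Data.Rational.Unnormalised.Properties as ℚᵘ
open import Data.Product.Base using (_×_; _,_)
open import Relation.Binary.PropositionalEquality

private
  variable
    a b c u : ℤ

module _ where
  open import Data.Integer.Base using (_+_; _*_; _-_; _^_; _≤_; _<_)
  open +-*-Solver

  -- Signs of integer sums, products and powers.

  0≤+ : ∀ n → 0ℤ ≤ + n
  0≤+ n = +≤+ z≤n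

  0<1+ : ∀ n → 0ℤ < + suc n
  0<1+ n = +<+ (s≤s z≤n)

  +-nonNeg : 0ℤ ≤ a → 0ℤ ≤ b → 0ℤ ≤ a + b
  +-nonNeg = ℤ.+-mono-≤

  +-pos-nonNeg : 0ℤ < a → 0ℤ ≤ b → 0ℤ < a + b
  +-pos-nonNeg = ℤ.+-mono-<-≤

  *-nonNeg : 0ℤ ≤ a → 0ℤ ≤ b → 0ℤ ≤ a * b
  *-nonNeg {+ m} {+ n} _ _ = subst (0ℤ ≤_) (ℤ.pos-* m n) (0≤+ (m ℕ.* n))

  *-pos : 0ℤ < a → 0ℤ < b → 0ℤ < a * b
  *-pos {ℤ.+[1+ m ]} {ℤ.+[1+ n ]} _ _ = +<+ (s≤s z≤n)
  *-pos {+ 0} (+<+ ())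
  *-pos {ℤ.+[1+ m ]} {+ 0} _ (+<+ ())

  ^-nonNeg : ∀ n → 0ℤ ≤ a → 0ℤ ≤ a ^ n
  ^-nonNeg 0       _   = 0≤+ 1
  ^-nonNeg (suc n) 0≤a = *-nonNeg 0≤a (^-nonNeg n 0≤a)

  ^-pos : ∀ n → 0ℤ < a → 0ℤ < a ^ n
  ^-pos 0       _   = +<+ (s≤s z≤n)
  ^-pos (suc n) 0<a = *-pos 0<a (^-pos n 0<a)

  0<i-j⇒j<i : 0ℤ < a - b → b < a
  0<i-j⇒j<i {a} {b} 0<a-b = subst₂ _<_ (ℤ.+-identityˡ b)
    (trans (ℤ.+-assoc a (ℤ.- b) b) (trans (cong (λ z → a + z) (ℤ.+-inverseˡ b)) (ℤ.+-identityʳ a)))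
    (ℤ.+-monoˡ-< b 0<a-b)

  *-cancelˡ-pos : 0ℤ < c → 0ℤ < c * a → 0ℤ < a
  *-cancelˡ-pos {c} {a} 0<c 0<ca =
    ℤ.*-cancelˡ-<-nonNeg c {{ℤ.nonNegative (ℤ.<⇒≤ 0<c)}} (subst (_< c * a) (sym (ℤ.*-zeroʳ c)) 0<ca)

  *-cancelˡ-nonNeg : 0ℤ < c → 0ℤ ≤ c * a → 0ℤ ≤ a
  *-cancelˡ-nonNeg {c} {a} 0<c 0≤ca =
    ℤ.*-cancelˡ-≤-pos 0ℤ a c {{ℤ.positive 0<c}} (subst (_≤ c * a) (sym (ℤ.*-zeroʳ c)) 0≤ca)

  -- The ring solver proves polynomial identities only, so the recurrence enters them as a multiple
  -- of `residual`; once `residual` vanishes, that multiple is discarded here.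
  modulo : ∀ e → u ≡ 0ℤ → a ≡ b + e * u → a ≡ b
  modulo {b = b} e refl a≡b+eu =
    trans a≡b+eu (trans (cong (λ z → b + z) (ℤ.*-zeroʳ e)) (ℤ.+-identityʳ b))

  -- Defect, slack and gaps.

  recurrenceRHS : (m r s : ℤ) → ℤ
  recurrenceRHS m r s = + 4 * (+ 3 * m ^ 2 + + 3 * m + + 1) * s - + 32 * m ^ 2 * r

  residual : (m r s t : ℤ) → ℤ
  residual m r s t = (m + + 1) ^ 2 * t - recurrenceRHS m r s

  -- Along the sequence this is 8^m times the drop of n S(n) / 8^n from n = m - 1 to n = m; 8 is the
  -- larger root of z² - 12 z + 32, the limiting characteristic polynomial.
  defect : (m r s : ℤ) → ℤ
  defect m r s = + 8 * (m - + 1) * r - m * s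

  slack : (m r s : ℤ) → ℤ
  slack m r s = + 3 * s - m ^ 2 * defect m r s

  convexityGap : (r s t : ℤ) → ℤ
  convexityGap r s t = t * r - s ^ 2

  -- The upper inequality with its denominator m (m - 1) cleared.
  upperGap : (m r s t : ℤ) → ℤ
  upperGap m r s t = (m * (m - + 1) + + 1) * s ^ 2 - m * (m - + 1) * (t * r)

  private
    # : ∀ {k} → ℕ → Polynomial k
    # n = con (+ n)

    :recurrenceRHS :defect :slack : ∀ {k} (m r s : Polynomial k) → Polynomial k
    :recurrenceRHS m r s =
      # 4 :* (# 3 :* m :^ 2 :+ # 3 :* m :+ # 1) :* s :- # 32 :* m :^ 2 :* r
    :defect m r s = # 8 :* (m :- # 1) :* r :- m :* s
    :slack m r s = # 3 :* s :- m :^ 2 :* :defect m r s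

    :convexityGap : ∀ {k} (r s t : Polynomial k) → Polynomial k
    :convexityGap r s t = t :* r :- s :^ 2

    :residual :upperGap : ∀ {k} (m r s t : Polynomial k) → Polynomial k
    :residual m r s t = (m :+ # 1) :^ 2 :* t :- :recurrenceRHS m r s
    :upperGap m r s t = (m :* (m :- # 1) :+ # 1) :* s :^ 2 :- m :* (m :- # 1) :* (t :* r)

  -- Polynomial identities.

  slack-identity : ∀ m r s → + 3 * s ≡ m ^ 2 * defect m r s + slack m r s
  slack-identity = solve 3 (λ m r s →
    # 3 :* s := m :^ 2 :* :defect m r s :+ :slack m r s) refl

  -- From here on m = 8 + x, which makes the coefficients visibly positive.
  defect-identity : ∀ x r s t → let m = + 8 + x in
    (x + + 9) * (x + + 7) * defect (+ 1 + m) s t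
      ≡ + 4 * s + + 4 * (m ^ 2 * defect m r s) + ℤ.- (x + + 7) * residual m r s t
  defect-identity = solve 4 (λ x r s t → let m = # 8 :+ x in
    (x :+ # 9) :* (x :+ # 7) :* :defect (# 1 :+ m) s t
      := # 4 :* s :+ # 4 :* (m :^ 2 :* :defect m r s) :+ :- (x :+ # 7) :* :residual m r s t) refl

  -- Substituting (m + 1) t = 8 m s - d′ and (m² - 1) d′ = 16 s - 4 p gives `s` the coefficient 8
  -- (m³ - 6m² - 9m - 8), negative at m = 7 and positive from m = 8 on: hence the start of the
  -- induction.
  slack-step-identity : ∀ x r s t → let m = + 8 + x in
    (x + + 9) ^ 2 * (x + + 7) * slack (+ 1 + m) s t
      ≡ + 8 * (x ^ 3 + + 18 * x ^ 2 + + 87 * x + + 48) * s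
          + + 4 * ((x + + 9) ^ 3 + + 3) * slack m r s
        + (x + + 7) * (+ 3 + (x + + 9) ^ 3) * residual m r s t
  slack-step-identity = solve 4 (λ x r s t → let m = # 8 :+ x in
    (x :+ # 9) :^ 2 :* (x :+ # 7) :* :slack (# 1 :+ m) s t
      := # 8 :* (x :^ 3 :+ # 18 :* x :^ 2 :+ # 87 :* x :+ # 48) :* s
          :+ # 4 :* ((x :+ # 9) :^ 3 :+ # 3) :* :slack m r s
        :+ (x :+ # 7) :* (# 3 :+ (x :+ # 9) :^ 3) :* :residual m r s t) refl

  -- Multiply (m + 1) t = 8 m s - d′ by 8 (m - 1) r = m s + d and eliminate d′. The term -4 m² d²
  -- that appears becomes -12 s d + 4 d p by m² d = 3 s - p.
  convexityGap-identity : ∀ x r s t → let m = + 8 + x; d = defect m r s in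
    + 8 * ((x + + 9) * (x + + 7)) ^ 2 * convexityGap r s t
      ≡ (+ 8 * x ^ 2 + + 124 * x + + 472) * s ^ 2
          + (+ 4 * x ^ 3 + + 96 * x ^ 2 + + 760 * x + + 1968) * (s * d)
          + + 4 * (d * slack m r s)
        + + 8 * (x + + 7) ^ 2 * r * residual m r s t
  convexityGap-identity = solve 4 (λ x r s t → let m = # 8 :+ x; d = :defect m r s in
    # 8 :* ((x :+ # 9) :* (x :+ # 7)) :^ 2 :* :convexityGap r s t
      := (# 8 :* x :^ 2 :+ # 124 :* x :+ # 472) :* s :^ 2
          :+ (# 4 :* x :^ 3 :+ # 96 :* x :^ 2 :+ # 760 :* x :+ # 1968) :* (s :* d)
          :+ # 4 :* (d :* :slack m r s)
        :+ # 8 :* (x :+ # 7) :^ 2 :* r :* :residual m r s t) refl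

  -- Since (m + 1)(m² - m + 1) = m³ + 1, the top-degree s² terms cancel, leaving (12m² - 8) s² -
  -- (4m⁴ - 8m² - 4m) s d + 4 m³ d². By m² d = 3 s - p the first two terms become 16 s² + 4 m s d +
  -- (4m² - 8) s p.
  upperGap-identity : ∀ x r s t → let m = + 8 + x; d = defect m r s in
    + 8 * ((x + + 9) ^ 2 * (x + + 7)) * upperGap m r s t
      ≡ + 16 * s ^ 2
          + + 4 * m * (s * d)
          + (+ 4 * x ^ 2 + + 64 * x + + 248) * (s * slack m r s)
          + + 4 * m ^ 3 * d ^ 2
        + ℤ.- (+ 8 * m * (x + + 7) ^ 2 * r) * residual m r s t
  upperGap-identity = solve 4 (λ x r s t → let m = # 8 :+ x; d = :defect m r s in
    # 8 :* ((x :+ # 9) :^ 2 :* (x :+ # 7)) :* :upperGap m r s t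
      := # 16 :* s :^ 2
          :+ # 4 :* m :* (s :* d)
          :+ (# 4 :* x :^ 2 :+ # 64 :* x :+ # 248) :* (s :* :slack m r s)
          :+ # 4 :* m :^ 3 :* d :^ 2
        :+ :- (# 8 :* m :* (x :+ # 7) :^ 2 :* r) :* :residual m r s t) refl

  -- The step from m to m + 1 and the gaps at m, for m ≥ 8.

  record Controlled (m r s : ℤ) : Set where
    field
      0<defect : 0ℤ < defect m r s
      0≤slack  : 0ℤ ≤ slack m r s

  record Gaps (m r s t : ℤ) : Set where
    field
      0<convexityGap : 0ℤ < convexityGap r s t
      0<upperGap     : 0ℤ < upperGap m r s t

  module _ (k : ℕ) (r s t : ℤ) (res : residual (+ (8 ℕ.+ k)) r s t ≡ 0ℤ)
           (ctrl : Controlled (+ (8 ℕ.+ k)) r s) where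
    open Controlled ctrl

    private
      x m d : ℤ
      x = + k
      m = + 8 + x
      d = defect m r s

      0<x+ : ∀ n → 0ℤ < x + + suc n
      0<x+ n = subst (0ℤ <_) (ℤ.+-comm (+ suc n) x) (+<+ (s≤s z≤n))

      0≤x : 0ℤ ≤ x
      0≤x = 0≤+ k

      0<d = 0<defect
      0≤d = ℤ.<⇒≤ 0<d

      0<m : 0ℤ < m
      0<m = 0<1+ _

      0≤m : 0ℤ ≤ m
      0≤m = 0≤+ _

    -- Positivity is read off from the control: 3 s = m² d + p with m² d positive and p nonnegative.
    0<s : 0ℤ < s
    0<s = *-cancelˡ-pos {+ 3} (0<1+ 2) (subst (0ℤ <_) (sym (slack-identity m r s))
      (+-pos-nonNeg (*-pos (^-pos 2 0<m) 0<d) 0≤slack))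

    private
      0≤s = ℤ.<⇒≤ 0<s

    controlled-step : Controlled (+ 1 + m) s t
    controlled-step = record
      { 0<defect = *-cancelˡ-pos (*-pos (0<x+ 8) (0<x+ 6))
          (subst (0ℤ <_) (sym (modulo (ℤ.- (x + + 7)) res (defect-identity x r s t)))
            (+-pos-nonNeg (*-pos (0<1+ 3) 0<s) (*-nonNeg (0≤+ 4) (*-nonNeg (^-nonNeg 2 0≤m) 0≤d))))
      ; 0≤slack = *-cancelˡ-nonNeg (*-pos (^-pos 2 (0<x+ 8)) (0<x+ 6))
          (subst (0ℤ ≤_) (sym (modulo ((x + + 7) * (+ 3 + (x + + 9) ^ 3)) res (slack-step-identity x r s t)))
            (+-nonNeg
              (*-nonNeg
                (*-nonNeg (0≤+ 8)
                  (+-nonNeg (+-nonNeg (+-nonNeg (^-nonNeg 3 0≤x) (*-nonNeg (0≤+ 18) (^-nonNeg 2 0≤x)))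
                    (*-nonNeg (0≤+ 87) 0≤x)) (0≤+ 48)))
                0≤s)
              (*-nonNeg (*-nonNeg (0≤+ 4) (+-nonNeg (^-nonNeg 3 (ℤ.<⇒≤ (0<x+ 8))) (0≤+ 3))) 0≤slack)))
      }

    gaps : Gaps m r s t
    gaps = record
      { 0<convexityGap = *-cancelˡ-pos (*-pos (0<1+ 7) (^-pos 2 (*-pos (0<x+ 8) (0<x+ 6))))
          (subst (0ℤ <_) (sym (modulo (+ 8 * (x + + 7) ^ 2 * r) res (convexityGap-identity x r s t)))
            (+-pos-nonNeg
              (+-pos-nonNeg
                (*-pos (ℤ.+-mono-≤-< (+-nonNeg (*-nonNeg (0≤+ 8) (^-nonNeg 2 0≤x)) (*-nonNeg (0≤+ 124) 0≤x)) (0<1+ 471))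
                  (^-pos 2 0<s))
                (*-nonNeg
                  (+-nonNeg (+-nonNeg (+-nonNeg (*-nonNeg (0≤+ 4) (^-nonNeg 3 0≤x))
                    (*-nonNeg (0≤+ 96) (^-nonNeg 2 0≤x))) (*-nonNeg (0≤+ 760) 0≤x)) (0≤+ 1968))
                  (*-nonNeg 0≤s 0≤d)))
              (*-nonNeg (0≤+ 4) (*-nonNeg 0≤d 0≤slack))))
      ; 0<upperGap = *-cancelˡ-pos (*-pos (0<1+ 7) (*-pos (^-pos 2 (0<x+ 8)) (0<x+ 6)))
          (subst (0ℤ <_) (sym (modulo (ℤ.- (+ 8 * m * (x + + 7) ^ 2 * r)) res (upperGap-identity x r s t)))
            (+-pos-nonNeg
              (+-pos-nonNeg
                (+-pos-nonNeg
                  (*-pos (0<1+ 15) (^-pos 2 0<s))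
                  (*-nonNeg (*-nonNeg (0≤+ 4) 0≤m) (*-nonNeg 0≤s 0≤d)))
                (*-nonNeg
                  (+-nonNeg (+-nonNeg (*-nonNeg (0≤+ 4) (^-nonNeg 2 0≤x)) (*-nonNeg (0≤+ 64) 0≤x)) (0≤+ 248))
                  (*-nonNeg 0≤s 0≤slack)))
              (*-nonNeg (*-nonNeg (0≤+ 4) (^-nonNeg 3 0≤m)) (^-nonNeg 2 0≤d))))
      }

  -- Initial values and the induction along the sequence.

  record Values (S : ℕ → ℤ) : Set where
    field
      S₁ : S 1 ≡ + 4
      S₂ : S 2 ≡ + 20
      S₃ : S 3 ≡ + 112
      S₄ : S 4 ≡ + 676
      S₅ : S 5 ≡ + 4304
      S₆ : S 6 ≡ + 28496
      S₇ : S 7 ≡ + 194240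
      S₈ : S 8 ≡ + 1353508

  module _ {S : ℕ → ℤ} (isS : IsSequenceS S) where
    open IsSequenceS isS

    -- The recurrence gives only (n + 1)² times the next value, so a candidate `c` is proposed,
    -- checked against the right-hand side by evaluation, and the square is cancelled.
    next-value : ∀ n .{{_ : ℤ.NonZero ((+ n + + 1) ^ 2)}} → 1 ℕ.≤ n →
      S (n ℕ.∸ 1) ≡ a → S n ≡ b →
      (+ n + + 1) ^ 2 * c ≡ recurrenceRHS (+ n) a b → S (n ℕ.+ 1) ≡ c
    next-value {c = c} n 1≤n refl refl eq = ℤ.*-cancelˡ-≡ ((+ n + + 1) ^ 2) (S (n ℕ.+ 1)) c
      (trans (recurrence n 1≤n) (sym eq))

    values : Values S
    values = record
      { S₁ = S₁ ; S₂ = S₂ ; S₃ = S₃ ; S₄ = S₄ ; S₅ = S₅ ; S₆ = S₆ ; S₇ = S₇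
      ; S₈ = next-value 7 (s≤s z≤n) S₆ S₇ refl }
      where
      S₂ = next-value {c = + 20} 1 (s≤s z≤n) S₀ S₁ refl
      S₃ = next-value {c = + 112} 2 (s≤s z≤n) S₁ S₂ refl
      S₄ = next-value {c = + 676} 3 (s≤s z≤n) S₂ S₃ refl
      S₅ = next-value {c = + 4304} 4 (s≤s z≤n) S₃ S₄ refl
      S₆ = next-value {c = + 28496} 5 (s≤s z≤n) S₄ S₅ refl
      S₇ = next-value {c = + 194240} 6 (s≤s z≤n) S₅ S₆ refl

    residual-S : ∀ n → residual (+ suc n) (S n) (S (suc n)) (S (2 ℕ.+ n)) ≡ 0ℤ
    -- The recurrence at `suc n` produces the index `suc n + 1`, which is `2 + n` only up to
    -- commutativity.
    residual-S n = subst (λ j → residual (+ suc n) (S n) (S (suc n)) (S j) ≡ 0ℤ) (ℕ.+-comm (suc n) 1)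
      (ℤ.i≡j⇒i-j≡0 (recurrence (suc n) (s≤s z≤n)))

    controlled-S : ∀ k → Controlled (+ (8 ℕ.+ k)) (S (7 ℕ.+ k)) (S (8 ℕ.+ k))
    -- At m = 8 evaluation gives defect 49376 and slack 900460.
    controlled-S 0 rewrite Values.S₇ values | Values.S₈ values = record
      { 0<defect = 0<1+ _ ; 0≤slack = 0≤+ _ }
    controlled-S (suc k) =
      controlled-step k _ _ _ (residual-S (7 ℕ.+ k)) (controlled-S k)

    gaps-S : ∀ n → 1 ℕ.≤ n → Gaps (+ suc n) (S n) (S (suc n)) (S (2 ℕ.+ n))
    gaps-S 1 _ rewrite Values.S₁ values | Values.S₂ values | Values.S₃ values =
      record { 0<convexityGap = 0<1+ _ ; 0<upperGap = 0<1+ _ }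
    gaps-S 2 _ rewrite Values.S₂ values | Values.S₃ values | Values.S₄ values =
      record { 0<convexityGap = 0<1+ _ ; 0<upperGap = 0<1+ _ }
    gaps-S 3 _ rewrite Values.S₃ values | Values.S₄ values | Values.S₅ values =
      record { 0<convexityGap = 0<1+ _ ; 0<upperGap = 0<1+ _ }
    gaps-S 4 _ rewrite Values.S₄ values | Values.S₅ values | Values.S₆ values =
      record { 0<convexityGap = 0<1+ _ ; 0<upperGap = 0<1+ _ }
    gaps-S 5 _ rewrite Values.S₅ values | Values.S₆ values | Values.S₇ values =
      record { 0<convexityGap = 0<1+ _ ; 0<upperGap = 0<1+ _ }
    gaps-S 6 _ rewrite Values.S₆ values | Values.S₇ values | Values.S₈ values =
      record { 0<convexityGap = 0<1+ _ ; 0<upperGap = 0<1+ _ }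
    -- Here n = 7 + k, so m = 8 + k is in the range of the induction.
    gaps-S (suc (suc (suc (suc (suc (suc (suc k))))))) _ =
      gaps k _ _ _ (residual-S (7 ℕ.+ k)) (controlled-S k)

-- Passage to the rationals.

open import Data.Rational.Base using (1ℚ; _+_; _*_; _<_; *<*; _/_; toℚᵘ)

fromℤ-mono-< : a ℤ.< b → fromℤ a < fromℤ b
fromℤ-mono-< {a} {b} a<b = *<* (subst₂ ℤ._<_ (sym (ℤ.*-identityʳ a)) (sym (ℤ.*-identityʳ b)) a<b)

-- Arithmetic in ℚ reduces to lowest terms, so the claim moves to unnormalised fractions. There 1 +
-- 1/c computes to (1·c + 1)/(1·c) and the order is cross-multiplication, which is the hypothesis up
-- to unit factors.
fromℤ<[1+1/c]*fromℤ : ∀ c .{{_ : ℕ.NonZero c}} → + c ℤ.* a ℤ.< (+ c ℤ.+ + 1) ℤ.* b →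
  fromℤ a < (1ℚ + + 1 / c) * fromℤ b
fromℤ<[1+1/c]*fromℤ {a} {b} c@(suc n) ca<[c+1]b = ℚ.toℚᵘ-cancel-<
  (ℚᵘ.<-respʳ-≃ (ℚᵘ.≃-sym homo) (ℚᵘ.*<* (subst₂ ℤ._<_ lhs rhs ca<[c+1]b)))
  where
  q = ℚᵘ.mkℚᵘ (+ 1) n
  homo : toℚᵘ ((1ℚ + + 1 / c) * fromℤ b) ℚᵘ.≃ (ℚᵘ.1ℚᵘ ℚᵘ.+ q) ℚᵘ.* toℚᵘ (fromℤ b)
  homo = ℚᵘ.≃-trans (ℚ.toℚᵘ-homo-* (1ℚ + + 1 / c) (fromℤ b))
    (ℚᵘ.*-congʳ (ℚᵘ.≃-trans (ℚ.toℚᵘ-homo-+ 1ℚ (+ 1 / c)) (ℚᵘ.+-congʳ ℚᵘ.1ℚᵘ (ℚ.toℚᵘ-fromℚᵘ q))))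
  lhs : + c ℤ.* a ≡ a ℤ.* + suc ((n ℕ.+ 0) ℕ.* 1)
  lhs = trans (ℤ.*-comm (+ c) a)
    (cong (λ k → a ℤ.* + suc k) (sym (trans (ℕ.*-identityʳ (n ℕ.+ 0)) (ℕ.+-identityʳ n))))
  rhs : (+ c ℤ.+ + 1) ℤ.* b ≡ (+ 1 ℤ.* + c ℤ.+ + 1) ℤ.* b ℤ.* + 1
  rhs = sym (trans (ℤ.*-identityʳ _) (cong (λ k → (k ℤ.+ + 1) ℤ.* b) (ℤ.*-identityˡ (+ c))))

theorem4p1 : (S : ℕ → ℤ) → IsSequenceS S → ∀ m → (2≤m : 2 ℕ.≤ m) →
    (fromℤ (S m ℤ.^ 2) < fromℤ (S (m ℕ.+ 1) ℤ.* S (m ℕ.∸ 1))) ×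
    (fromℤ (S (m ℕ.+ 1) ℤ.* S (m ℕ.∸ 1)) < (1ℚ + 1/m[m-1] m 2≤m) * fromℤ (S m ℤ.^ 2))
theorem4p1 S isS m@(suc (suc n)) (s≤s (s≤s z≤n)) rewrite ℕ.+-comm n 1 =
  fromℤ-mono-< (0<i-j⇒j<i 0<convexityGap) ,
  fromℤ<[1+1/c]*fromℤ (m ℕ.* (m ℕ.∸ 1))
    -- `upperGap` forms m (m - 1) in ℤ, the denominator forms it in ℕ; `pos-*` identifies the two.
    (subst (λ c → c ℤ.* (S (suc m) ℤ.* S (suc n)) ℤ.< (c ℤ.+ + 1) ℤ.* S m ℤ.^ 2)
      (sym (ℤ.pos-* m (suc n))) (0<i-j⇒j<i 0<upperGap))
  where open Gaps (gaps-S isS (suc n) (s≤s z≤n))
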